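{- Let $\mathcal{H}=(V,E)$ be a loopless hypergraph such that $$\Delta(\mathcal{H})\le\sqrt{\Delta([\mathcal{H}]_2)+1}+1.$$ Then $\mathrm{q}(\mathcal{H})\le\Delta([\mathcal{H}]_2)+1$.
   Context: A hypergraph $\mathcal{H}=(V,E)$ consists of a finite nonempty set $V$ of vertices and a nonempty set $E$ of nonempty subsets of $V$, called hyperedges. It is not assumed to be linear, i.e. two distinct hyperedges may share more than one vertex. A loop is a hyperedge $e$ with $|e|=1$; $\mathcal{H}$ is loopless if it has no loop. The degree of a vertex $x\in V$ is $\deg_{\mathcal{H}}(x)=|\{a\in E: x\in a\}|$, and the maximum degree of $\mathcal{H}$ is $\Delta(\mathcal{H})=\max_{x\in V}\deg_{\mathcal{H}}(x)$. The 2-section of $\mathcal{H}$ is the loopless multigraph $[\mathcal{H}]_2$ with vertex set $V$ in which two distinct vertices $x,y$ are joined by exactly $m$ parallel edges, where $m$ is the number of hyperedges of $\mathcal{H}$ containing both $x$ and $y$. $\Delta([\mathcal{H}]_2)$ denotes the maximum degree of this multigraph, with edges counted with multiplicity; thus the degree of $x$ in $[\mathcal{H}]_2$ is $\sum_{e\in E,\ x\in e}(|e|-1)$. The chromatic index $\mathrm{q}(\mathcal{H})$ is the least integer $q$ such that there exists a map $c:E\to\{1,2,\dots,q\}$ satisfying: for all $e,e'\in E$, $c(e)=c(e')$ implies $e\cap e'=\varnothing$ or $e=e'$. -}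

module Defs where

open import Data.Bool.Properties using () renaming (_≟_ to _≟ᵇ_)
open import Data.Empty using (⊥-elim)
open import Data.Fin using (Fin; finToFun; funToFin)
open import Data.Fin.Properties using (any?; all?; finToFun-funToFin) renaming (_≟_ to _≟ᶠ_)
open import Data.Fin.Subset using (Subset; _∈_; _∩_; ∣_∣; Nonempty; Empty)
open import Data.Fin.Subset.Properties using (_∈?_; nonempty?)
open import Data.List using (List; []; length; filter; lookup; tabulate)
open import Data.List.Extrema.Nat using (max)
open import Data.List.Properties using (filter-≐)
open import Data.List.Relation.Unary.All using (All)
open import Data.List.Relation.Unary.Unique.Propositional using (Unique)
open import Data.Nat using (ℕ; zero; suc; _*_; _∸_; _≤_; z≤n; s≤s; NonZero)
open import Data.Nat.ListAction using (sum)
open import Data.Product using (∃; _×_; _,_; proj₁; proj₂; swap)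
open import Data.Sum using (_⊎_; inj₂)
open import Data.Vec.Properties using (≡-dec)
open import Relation.Binary.PropositionalEquality
  using (_≡_; _≢_; refl; sym; trans; cong)
open import Relation.Nullary using (Dec; yes; no; ¬?)
open import Relation.Nullary.Decidable using (map′; _×-dec_; _⊎-dec_; _→-dec_)

-- The vertex set is Fin order; E lists the hyperedges without repetition,
-- so that two hyperedges may share any number of vertices but E is a set.
record Hypergraph : Set where
  field
    order         : ℕ
    V-nonempty    : NonZero order
    E             : List (Subset order)
    E-unique      : Unique E
    E-nonempty    : E ≢ []
    edge-nonempty : All Nonempty E

  Vertex : Set
  Vertex = Fin order

  Edge : Set
  Edge = Fin (length E)

  verts : Edge → Subset order
  verts = lookup E

open Hypergraph public

Loopless : Hypergraph → Set
Loopless H = All (λ e → ∣ e ∣ ≢ 1) (E H)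

deg : (H : Hypergraph) → Vertex H → ℕ
deg H x = length (filter (λ a → x ∈? a) (E H))

-- The base value 0 does not affect the maximum of natural numbers
-- over a nonempty vertex set.
Δ : Hypergraph → ℕ
Δ H = max 0 (tabulate (deg H))

record LooplessMultigraph (n : ℕ) : Set where
  field
    mult        : Fin n → Fin n → ℕ
    mult-sym    : ∀ x y → mult x y ≡ mult y x
    mult-irrefl : ∀ x → mult x x ≡ 0

open LooplessMultigraph public

mdeg : ∀ {n} → LooplessMultigraph n → Fin n → ℕ
mdeg G x = sum (tabulate (mult G x))

mΔ : ∀ {n} → LooplessMultigraph n → ℕ
mΔ G = max 0 (tabulate (mdeg G))

codeg : (H : Hypergraph) → Vertex H → Vertex H → ℕ
codeg H x y = length (filter (λ e → (x ∈? e) ×-dec (y ∈? e)) (E H))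

codeg-sym : ∀ H x y → codeg H x y ≡ codeg H y x
codeg-sym H x y = cong length (filter-≐ _ _ (swap , swap) (E H))

sectionMult : (H : Hypergraph) → Vertex H → Vertex H → ℕ
sectionMult H x y with x ≟ᶠ y
... | yes _ = 0
... | no  _ = codeg H x y

sectionMult-sym : ∀ H x y → sectionMult H x y ≡ sectionMult H y x
sectionMult-sym H x y with x ≟ᶠ y | y ≟ᶠ x
... | yes _   | yes _   = refl
... | yes x≡y | no y≢x  = ⊥-elim (y≢x (sym x≡y))
... | no x≢y  | yes y≡x = ⊥-elim (x≢y (sym y≡x))
... | no _    | no _    = codeg-sym H x y

sectionMult-irrefl : ∀ H x → sectionMult H x x ≡ 0
sectionMult-irrefl H x with x ≟ᶠ x
... | yes _  = refl
... | no x≢x = ⊥-elim (x≢x refl)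

2-section : (H : Hypergraph) → LooplessMultigraph (order H)
2-section H = record
  { mult        = sectionMult H
  ; mult-sym    = sectionMult-sym H
  ; mult-irrefl = sectionMult-irrefl H
  }

ProperColouring : (H : Hypergraph) {q : ℕ} → (Edge H → Fin q) → Set
ProperColouring H c = ∀ e e′ → c e ≡ c e′ →
  Empty (verts H e ∩ verts H e′) ⊎ verts H e ≡ verts H e′

EdgeColourable : Hypergraph → ℕ → Set
EdgeColourable H q = ∃ λ (c : Edge H → Fin q) → ProperColouring H c

properColouring? : ∀ H {q} (c : Edge H → Fin q) → Dec (ProperColouring H c)
properColouring? H c = all? λ e → all? λ e′ → (c e ≟ᶠ c e′) →-dec
  (¬? (nonempty? (verts H e ∩ verts H e′)) ⊎-dec ≡-dec _≟ᵇ_ (verts H e) (verts H e′))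

-- Maps Edge H → Fin q are enumerated, up to pointwise equality, by
-- Fin (q ^ length (E H)).
edgeColourable? : ∀ H q → Dec (EdgeColourable H q)
edgeColourable? H q = map′
  (λ (k , p) → finToFun k , p)
  (λ (c , p) → funToFin c , λ e e′ eq →
    p e e′ (trans (sym (finToFun-funToFin c e)) (trans eq (finToFun-funToFin c e′))))
  (any? λ k → properColouring? H (finToFun {q} {length (E H)} k))

rainbow : ∀ H → EdgeColourable H (length (E H))
rainbow H = (λ e → e) , λ e e′ eq → inj₂ (cong (verts H) eq)

IsLeast : (ℕ → Set) → ℕ → Set
IsLeast P q = P q × (∀ r → P r → q ≤ r)

least : {P : ℕ → Set} → (∀ n → Dec (P n)) → ∀ n → P n → ∃ (IsLeast P)
least P? zero    p = 0 , p , λ _ _ → z≤n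
least P? (suc n) p with P? 0
... | yes p₀ = 0 , p₀ , λ _ _ → z≤n
... | no ¬p₀ with least (λ k → P? (suc k)) n p
...   | q , pq , minimal = suc q , pq , λ where
        zero    p₀ → ⊥-elim (¬p₀ p₀)
        (suc r) pr → s≤s (minimal r pr)

chromaticIndex : Hypergraph → ℕ
chromaticIndex H = proj₁ (least (edgeColourable? H) (length (E H)) (rainbow H))

chromaticIndex-isLeast : ∀ H → IsLeast (EdgeColourable H) (chromaticIndex H)
chromaticIndex-isLeast H = proj₂ (least (edgeColourable? H) (length (E H)) (rainbow H))

-- m ≤√ n +1 is the real inequality m ≤ √n + 1. For m ≥ 1 it says
-- (m - 1)² ≤ n; for m = 0 both sides hold, since 0 ∸ 1 = 0.
_≤√_+1 : ℕ → ℕ → Set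
m ≤√ n +1 = (m ∸ 1) * (m ∸ 1) ≤ n

{-# OPTIONS --safe #-}
module Submission where

-- Write D for Δ([H]₂) and colour the line graph with N = D + 1 colours, by induction on the set S of
-- hyperedges. A hyperedge with fewer than N neighbours in S can be removed and coloured last. If there
-- is none, counting the neighbours of a smallest hyperedge e, of size k, point by point shows N = k²,
-- that every point of e lies on exactly k other hyperedges of S, all of size k, and that e shares at
-- most one point with each of them. This extremal case is treated in the spirit of Brooks' theorem:
-- the smallest hyperedges contain a configuration f, p, q, …, g in which p, q, …, g is a walk, f meets
-- p, q and g, and g meets only f and one hyperedge ℓ of the walk. Colour everything else first. Then f
-- has at least three free colours and g at least two, so f can be coloured so that g keeps a free
-- colour whatever ℓ gets, and the walk can be coloured greedily.
-- A triangle with three distinct corners gives a configuration, because k + 1 hyperedges through a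
-- corner cannot all meet the opposite side, which has k points. So does an induced cycle of length
-- at least 4, by inserting a third hyperedge through one of its corners.

open import Defs
open import Algebra.Properties.CommutativeSemigroup using (x∙yz≈y∙xz)
open import Data.Bool using (true; false)
open import Data.Fin using (Fin; suc)
open import Data.Fin.Properties using (any?) renaming (_≟_ to _≟ᶠ_)
open import Data.Fin.Subset using (Subset; ∣_∣; inside; outside; Nonempty; Empty; _∩_)
  renaming (_∈_ to _∈ₛ_; _∉_ to _∉ₛ_)
open import Data.Fin.Subset.Properties using (drop-there; x∈p∩q⁻) renaming (_∈?_ to _∈ₛ?_)
open import Data.List
  using (List; []; _∷_; _++_; [_]; length; filter; map; allFin; concatMap; tabulate)
open import Data.List.Extrema.Nat using (xs≤max; argmin; argmin-sel; f[argmin]≤f[⊤]; f[argmin]≤f[xs])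
import Data.List.Membership.DecPropositional as DecMembership
open import Data.List.Membership.Propositional using (_∈_; _∉_; find; lose)
open import Data.List.Membership.Propositional.Properties
  using (∈-∃++; ∈-++⁺ˡ; ∈-++⁺ʳ; ∈-++⁻; ∈-filter⁺; ∈-filter⁻; ∈-allFin; ∈-map⁺; ∈-concatMap⁺; ∈-lookup; ∈-tabulate⁺)
open import Data.List.Properties
  using (length-map; length-++; length-tabulate; map-tabulate; tabulate-lookup; filter-≐; map-∘; length-filter; filter-notAll)
open import Data.List.Relation.Binary.Permutation.Propositional.Properties using (shift) renaming (map⁺ to ↭-map⁺)
open import Data.List.Relation.Binary.Subset.Propositional using (_⊆_)
open import Data.List.Relation.Unary.All as All using (All; []; _∷_)
open import Data.List.Relation.Unary.AllPairs using ([]; _∷_)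
open import Data.List.Relation.Unary.Any as Any using (here; there)
open import Data.List.Relation.Unary.Linked using (Linked; [-]; _∷_)
open import Data.List.Relation.Unary.Unique.Propositional using (Unique)
open import Data.List.Relation.Unary.Unique.Propositional.Properties
  using (allFin⁺; Unique[x∷xs]⇒x∉xs) renaming (filter⁺ to Unique-filter⁺; ++⁺ to Unique-++⁺)
open import Data.Nat using (ℕ; zero; suc; _+_; _*_; _∸_; _≤_; _<_; _<?_; z≤n; s≤s)
open import Data.Nat.ListAction using (sum)
open import Data.Nat.ListAction.Properties using (sum-↭)
open import Data.Nat.Properties
open import Data.Nat.Tactic.RingSolver using (solve-∀)
open import Data.Product using (∃; _×_; _,_; proj₁; proj₂)
open import Data.Sum using (_⊎_; inj₁; inj₂)
open import Data.Vec using ([]; _∷_) renaming (there to thereᵥ)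
open import Data.Vec.Functional using (updateAt)
open import Data.Vec.Functional.Properties using (updateAt-updates; updateAt-minimal)
open import Function using (const; _∘_; id)
open import Relation.Binary.Definitions using (tri<; tri≈; tri>)
open import Relation.Binary.PropositionalEquality
  using (_≡_; _≢_; refl; sym; trans; cong; subst; subst₂; module ≡-Reasoning)
open import Relation.Nullary using (¬_; Dec; yes; no; ¬?; contradiction; does)
open import Relation.Nullary.Decidable using (_×-dec_; decidable-stable)

-- Counting in lists without repetition

-- Induction on `xs`: the head is cut out of `ys`, and since `xs` has no repetition, the tail still
-- lies in what remains.
sum-map-⊆ : ∀ {A : Set} (h : A → ℕ) {xs ys} → Unique xs → xs ⊆ ys → sum (map h xs) ≤ sum (map h ys)
sum-map-⊆ h {[]} _ _ = z≤n
sum-map-⊆ h {x ∷ xs} u@(_ ∷ uxs) x∷xs⊆ys with as , bs , refl ← ∈-∃++ (x∷xs⊆ys (here refl)) = begin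
  h x + sum (map h xs)          ≤⟨ +-monoʳ-≤ (h x) (sum-map-⊆ h uxs xs⊆) ⟩
  h x + sum (map h (as ++ bs))  ≡⟨ sum-↭ (↭-map⁺ h (shift x as bs)) ⟨
  sum (map h (as ++ x ∷ bs))    ∎
  where
  open ≤-Reasoning
  xs⊆ : xs ⊆ as ++ bs
  xs⊆ {y} y∈xs with ∈-++⁻ as (x∷xs⊆ys (there y∈xs))
  ... | inj₁ y∈as            = ∈-++⁺ˡ y∈as
  ... | inj₂ (here refl)     = contradiction y∈xs (Unique[x∷xs]⇒x∉xs u)
  ... | inj₂ (there y∈bs)    = ∈-++⁺ʳ as y∈bs

sum-map-const-1 : ∀ {A : Set} (xs : List A) → sum (map (const 1) xs) ≡ length xs
sum-map-const-1 []       = refl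
sum-map-const-1 (_ ∷ xs) = cong suc (sum-map-const-1 xs)

length-⊆ : ∀ {A : Set} {xs ys : List A} → Unique xs → xs ⊆ ys → length xs ≤ length ys
length-⊆ {xs = xs} {ys} u xs⊆ys =
  subst₂ _≤_ (sum-map-const-1 xs) (sum-map-const-1 ys) (sum-map-⊆ (const 1) u xs⊆ys)

length-concatMap : ∀ {A B : Set} (L : A → List B) xs →
                   length (concatMap L xs) ≡ sum (map (length ∘ L) xs)
length-concatMap L []       = refl
length-concatMap L (x ∷ xs) = trans (length-++ (L x)) (cong (length (L x) +_) (length-concatMap L xs))

-- The union bound. It serves to count hyperedges by the points through which they pass.
length-cover : ∀ {A B : Set} (L : A → List B) {P xs} → Unique xs →
               (∀ {z} → z ∈ xs → ∃ λ y → y ∈ P × z ∈ L y) →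
               length xs ≤ sum (map (length ∘ L) P)
length-cover L {P} u cover = ≤-trans
  (length-⊆ u λ z∈xs → let y , y∈P , z∈Ly = cover z∈xs in
    ∈-concatMap⁺ L (Any.map (λ where refl → z∈Ly) y∈P))
  (≤-reflexive (length-concatMap L P))

sum-map-≤ : ∀ {A : Set} (h : A → ℕ) {b} P → (∀ {x} → x ∈ P → h x ≤ b) → sum (map h P) ≤ length P * b
sum-map-≤ h []      _  = z≤n
sum-map-≤ h (x ∷ P) h≤ = +-mono-≤ (h≤ (here refl)) (sum-map-≤ h P (h≤ ∘ there))

sum-map-< : ∀ {A : Set} (h : A → ℕ) {b x} P → (∀ {y} → y ∈ P → h y ≤ b) → x ∈ P → h x < b →
            sum (map h P) < length P * b
sum-map-< h (y ∷ P) h≤ (here refl) hx<b = +-mono-<-≤ hx<b (sum-map-≤ h P (h≤ ∘ there))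
sum-map-< h (y ∷ P) h≤ (there x∈P) hx<b = +-mono-≤-< (h≤ (here refl)) (sum-map-< h P (h≤ ∘ there) x∈P hx<b)

sum-map-≥ : ∀ {A : Set} (h : A → ℕ) {b} P → (∀ {x} → x ∈ P → b ≤ h x) → length P * b ≤ sum (map h P)
sum-map-≥ h []      _  = z≤n
sum-map-≥ h (x ∷ P) h≥ = +-mono-≤ (h≥ (here refl)) (sum-map-≥ h P (h≥ ∘ there))

sum-map-> : ∀ {A : Set} (h : A → ℕ) {b x} P → (∀ {y} → y ∈ P → b ≤ h y) → x ∈ P → b < h x →
            length P * b < sum (map h P)
sum-map-> h (y ∷ P) h≥ (here refl) b<hx = +-mono-<-≤ b<hx (sum-map-≥ h P (h≥ ∘ there))
sum-map-> h (y ∷ P) h≥ (there x∈P) b<hx = +-mono-≤-< (h≥ (here refl)) (sum-map-> h P (h≥ ∘ there) x∈P b<hx)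

sum-map-*ˡ : ∀ {A : Set} (h : A → ℕ) k P → sum (map (λ x → k * h x) P) ≡ k * sum (map h P)
sum-map-*ˡ h k []      = sym (*-zeroʳ k)
sum-map-*ˡ h k (x ∷ P) = trans (cong (k * h x +_) (sum-map-*ˡ h k P)) (sym (*-distribˡ-+ k (h x) _))

length-singleton : ∀ {A : Set} {xs : List A} → Unique xs → (∀ {x y} → x ∈ xs → y ∈ xs → x ≡ y) → length xs ≤ 1
length-singleton {xs = []}         _               _  = z≤n
length-singleton {xs = x ∷ []}     _               _  = s≤s z≤n
length-singleton {xs = x ∷ y ∷ xs} ((x≢y ∷ _) ∷ _) eq = contradiction (eq (here refl) (there (here refl))) x≢y

-- Choosing colours outside given lists

module _ {n : ℕ} where
  open DecMembership (_≟ᶠ_ {n}) using (_∈?_)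

  avoid : (xs L : List (Fin n)) → Unique xs → length L < length xs → ∃ λ a → a ∈ xs × a ∉ L
  avoid xs L u L<xs with Any.any? (λ a → ¬? (a ∈? L)) xs
  ... | yes p = find p
  ... | no ¬p = contradiction
    (length-⊆ u λ {a} a∈xs → decidable-stable (a ∈? L) λ a∉L → ¬p (lose a∈xs a∉L))
    (<⇒≱ L<xs)

module _ {N : ℕ} where
  open DecMembership (_≟ᶠ_ {N}) using (_∈?_)

  fresh : (L : List (Fin N)) → length L < N → ∃ λ a → a ∉ L
  fresh L L<N = let a , _ , a∉L = avoid (allFin N) L (allFin⁺ N) (subst (length L <_) (sym (length-tabulate {n = N} id)) L<N)
                in a , a∉L

  -- As `c` already occurs in `G`, only `d` and the entries of `G` have to be avoided.
  reuse : ∀ {c} {G : List (Fin N)} → c ∈ G → 2 + length G ≤ N → ∀ d → ∃ λ a → a ∉ c ∷ d ∷ G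
  reuse {G = G} c∈G G≤ d with a , a∉ ← fresh (d ∷ G) G≤ = a , λ where
    (here refl) → a∉ (there c∈G)
    (there q)   → a∉ q

  -- Either some candidate for c is already in G, so that choosing it costs nothing,
  -- or three candidates avoid G, and two of them remain after the choice of c.
  fresh-pair : (F G : List (Fin N)) → 3 + length F ≤ N → 2 + length G ≤ N →
               ∃ λ c → c ∉ F × (∀ d → ∃ λ a → a ∉ c ∷ d ∷ G)
  fresh-pair F G F≤ G≤
    with fresh F (≤-trans (s≤s (m≤n+m _ 2)) F≤)
  ... | c₁ , c₁∉ with fresh (c₁ ∷ F) (≤-trans (s≤s (m≤n+m _ 1)) F≤)
  ... | c₂ , c₂∉ with fresh (c₂ ∷ c₁ ∷ F) F≤
  ... | c₃ , c₃∉ with c₁ ∈? G | c₂ ∈? G | c₃ ∈? G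
  ... | yes p | _ | _ = c₁ , c₁∉ , reuse p G≤
  ... | no _ | yes p | _ = c₂ , c₂∉ ∘ there , reuse p G≤
  ... | no _ | no _ | yes p = c₃ , c₃∉ ∘ there ∘ there , reuse p G≤
  ... | no c₁∉G | no c₂∉G | no c₃∉G = c₁ , c₁∉ , λ d → pick d (d ≟ᶠ c₂)
    where
    pick : ∀ d → Dec (d ≡ c₂) → ∃ λ a → a ∉ c₁ ∷ d ∷ G
    pick d (no d≢c₂) = c₂ , λ where
      (here refl)         → c₂∉ (here refl)
      (there (here refl)) → d≢c₂ refl
      (there (there q))   → c₂∉G q
    pick d (yes refl) = c₃ , λ where
      (here refl)         → c₃∉ (there (here refl))
      (there (here refl)) → c₃∉ (here refl)
      (there (there q))   → c₃∉G q

-- Greedy colouring for a symmetric relation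

module Colouring {m : ℕ} (Meets : Fin m → Fin m → Set) (meets? : ∀ e f → Dec (Meets e f))
                 (meets-sym : ∀ {e f} → Meets e f → Meets f e) (N : ℕ) where
  open DecMembership (_≟ᶠ_ {m}) using (_∈?_)

  Adjacent : Fin m → Fin m → Set
  Adjacent e f = f ≢ e × Meets e f

  adjacent? : ∀ e f → Dec (Adjacent e f)
  adjacent? e f = ¬? (f ≟ᶠ e) ×-dec meets? e f

  neighbours : Fin m → List (Fin m) → List (Fin m)
  neighbours e = filter (adjacent? e)

  -- A partial colouring is a total map of which only the values on `S` matter. The conclusion
  -- `e ≡ f` is needed because in the application a hyperedge, being nonempty, meets itself.
  Proper : (Fin m → Fin N) → List (Fin m) → Set
  Proper c S = ∀ {e f} → e ∈ S → f ∈ S → Meets e f → c e ≡ c f → e ≡ f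

  proper-⊆ : ∀ {c S S′} → S′ ⊆ S → Proper c S → Proper c S′
  proper-⊆ S′⊆S pr e∈ f∈ = pr (S′⊆S e∈) (S′⊆S f∈)

  proper-extend : ∀ {c D v a} → Proper c D → v ∉ D → (∀ {w} → w ∈ D → Meets v w → c w ≢ a) →
    ∃ λ c′ → Proper c′ (v ∷ D) × c′ v ≡ a × (∀ {w} → w ∈ D → c′ w ≡ c w)
  proper-extend {c} {D} {v} {a} pr v∉D free = c′ , pr′ , at-v , at-D
    where
    c′ : Fin m → Fin N
    c′ = updateAt c v (const a)
    at-v : c′ v ≡ a
    at-v = updateAt-updates v c
    at-D : ∀ {w} → w ∈ D → c′ w ≡ c w
    at-D {w} w∈D = updateAt-minimal w v c λ where refl → v∉D w∈D
    pr′ : Proper c′ (v ∷ D)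
    pr′ (here refl) (here refl) _   _  = refl
    pr′ (here refl) (there f∈D) vMf eq =
      contradiction (trans (sym (at-D f∈D)) (trans (sym eq) at-v)) (free f∈D vMf)
    pr′ (there e∈D) (here refl) eMv eq =
      contradiction (trans (sym (at-D e∈D)) (trans eq at-v)) (free e∈D (meets-sym eMv))
    pr′ (there e∈D) (there f∈D) eMf eq =
      pr e∈D f∈D eMf (trans (sym (at-D e∈D)) (trans eq (at-D f∈D)))

  colour-∉ : ∀ {c : Fin m → Fin N} {D v a} → v ∉ D → a ∉ map c (neighbours v D) → ∀ {w} → w ∈ D → Meets v w → c w ≢ a
  colour-∉ {c} {D} {v} v∉D a∉ w∈D vMw refl =
    a∉ (∈-map⁺ c (∈-filter⁺ (adjacent? v) w∈D ((λ where refl → v∉D w∈D) , vMw)))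

  greedy : ∀ {c D v} → Proper c D → v ∉ D → length (neighbours v D) < N →
    ∃ λ c′ → Proper c′ (v ∷ D) × (∀ {w} → w ∈ D → c′ w ≡ c w)
  greedy {c} {D} {v} pr v∉D room
    with a , a∉ ← fresh (map c (neighbours v D)) (subst (_< N) (sym (length-map c (neighbours v D))) room)
    with c′ , pr′ , _ , same ← proper-extend pr v∉D (colour-∉ {c} v∉D a∉)
    = c′ , pr′ , same

  -- With `D` the coloured part of `S`, each uncoloured neighbour of `v` saves one colour at `v`.
  -- All spare colours below come from this inequality.
  neighbours-+ : ∀ {S D v} ws → Unique ws → Unique D → D ⊆ S →
    (∀ {w} → w ∈ ws → w ∈ S × w ∉ D × Adjacent v w) →
    length ws + length (neighbours v D) ≤ length (neighbours v S)
  neighbours-+ {S} {D} {v} ws uws uD D⊆S hws = ≤-trans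
    (≤-reflexive (sym (length-++ ws)))
    (length-⊆ (Unique-++⁺ uws (Unique-filter⁺ (adjacent? v) uD)
                λ (p , q) → proj₁ (proj₂ (hws p)) (proj₁ (∈-filter⁻ (adjacent? v) q)))
              incl)
    where
    incl : ws ++ neighbours v D ⊆ neighbours v S
    incl z∈ with ∈-++⁻ ws z∈
    ... | inj₁ p = let w∈S , _ , adj = hws p in ∈-filter⁺ (adjacent? v) w∈S adj
    ... | inj₂ q = let w∈D , adj = ∈-filter⁻ (adjacent? v) q in ∈-filter⁺ (adjacent? v) (D⊆S w∈D) adj

  linked-next : ∀ {p} ps {g} → Linked Meets (p ∷ ps ++ [ g ]) → ∃ λ q → q ∈ ps ++ [ g ] × Meets p q
  linked-next []      (pMg ∷ _) = _ , here refl , pMg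
  linked-next (_ ∷ _) (pMq ∷ _) = _ , here refl , pMq

  linked-tail : ∀ {p} ps {g} → Linked Meets (p ∷ ps ++ [ g ]) → Linked Meets (ps ++ [ g ])
  linked-tail []      (_ ∷ l) = l
  linked-tail (_ ∷ _) (_ ∷ l) = l

  -- Every edge of the walk is coloured while its successor is still uncoloured.
  colour-walk : ∀ {S D c g} ps → Linked Meets (ps ++ [ g ]) → Unique (ps ++ [ g ]) →
    ps ++ [ g ] ⊆ S → (∀ {w} → w ∈ ps ++ [ g ] → w ∉ D) →
    Unique D → D ⊆ S → (∀ {v} → v ∈ ps → length (neighbours v S) ≤ N) → Proper c D →
    ∃ λ c′ → Proper c′ (ps ++ D) × (∀ {w} → w ∈ D → c′ w ≡ c w)
  colour-walk {c = c} [] _ _ _ _ _ _ _ pr = c , pr , λ _ → refl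
  colour-walk {S} {D} {c} {g} (p ∷ ps) link u@(p≢ ∷ u′) ⊆S ∉D uD D⊆S small pr
    with q , q∈ , pMq ← linked-next ps link
    with c₁ , pr₁ , same₁ ← greedy {c} {D} {p} pr (∉D (here refl)) (≤-trans
           (neighbours-+ {S} {v = p} [ q ] ([] ∷ []) uD D⊆S λ where
             (here refl) → ⊆S (there q∈) , ∉D (there q∈) , (λ where refl → Unique[x∷xs]⇒x∉xs u q∈) , pMq)
           (small (here refl)))
    with c₂ , pr₂ , same₂ ← colour-walk {S} {p ∷ D} {c₁} ps (linked-tail ps link) u′ (⊆S ∘ there)
           (λ w∈ → λ where
              (here refl) → Unique[x∷xs]⇒x∉xs u w∈
              (there w∈D) → ∉D (there w∈) w∈D)
           (All.tabulate (λ w∈D → λ where refl → ∉D (here refl) w∈D) ∷ uD)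
           (λ where
              (here refl) → ⊆S (here refl)
              (there w∈D) → D⊆S w∈D)
           (small ∘ there) pr₁
    = c₂ , proper-⊆ reorder pr₂ , λ w∈D → trans (same₂ (there w∈D)) (same₁ w∈D)
    where
    reorder : p ∷ ps ++ D ⊆ ps ++ p ∷ D
    reorder (here refl) = ∈-++⁺ʳ ps (here refl)
    reorder (there w∈) with ∈-++⁻ ps w∈
    ... | inj₁ q = ∈-++⁺ˡ q
    ... | inj₂ q = ∈-++⁺ʳ ps (there q)

  -- Configurations and the extension of colourings over them

  -- `small` allows one neighbour more than `greedy` tolerates. When only `D` is coloured, `p`, `q`,
  -- `g` are three uncoloured neighbours of `f`, and `f`, `ℓ` are two of `g`; each entry of `ps` is
  -- coloured while its successor is not. By `g-only-ℓ` the walk restricts `g` only through the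
  -- colour of `ℓ`.
  record Configuration (S : List (Fin m)) : Set where
    field
      f p q g ℓ : Fin m
      rest      : List (Fin m)
    ps : List (Fin m)
    ps = p ∷ q ∷ rest
    field
      unique   : Unique (f ∷ ps ++ [ g ])
      ⊆S       : f ∷ ps ++ [ g ] ⊆ S
      small    : ∀ {v} → v ∈ f ∷ ps ++ [ g ] → length (neighbours v S) ≤ N
      linked   : Linked Meets (ps ++ [ g ])
      f-p      : Meets f p
      f-q      : Meets f q
      f-g      : Meets f g
      g-ℓ      : Meets g ℓ
      ℓ∈       : ℓ ∈ ps
      g-only-ℓ : ∀ {w} → w ∈ ps → Meets g w → w ≡ ℓ

    C D : List (Fin m)
    C = f ∷ ps ++ [ g ]
    D = filter (λ w → ¬? (w ∈? C)) S

    D⊆S : D ⊆ S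
    D⊆S = proj₁ ∘ ∈-filter⁻ (λ w → ¬? (w ∈? C))

    D-∉C : ∀ {w} → w ∈ D → w ∉ C
    D-∉C = proj₂ ∘ ∈-filter⁻ (λ w → ¬? (w ∈? C)) {xs = S}

  ∉-initial : ∀ (xs : List (Fin m)) {g} → Unique (xs ++ [ g ]) → g ∉ xs
  ∉-initial (x ∷ xs) (x≢ ∷ u) (here refl) = All.lookup x≢ (∈-++⁺ʳ xs (here refl)) refl
  ∉-initial (x ∷ xs) (x≢ ∷ u) (there g∈)  = ∉-initial xs u g∈

  module _ {S} (K : Configuration S) (uS : Unique S) where
    open Configuration K

    private
      C-∉D : ∀ {w} → w ∈ C → w ∉ D
      C-∉D w∈C w∈D = D-∉C w∈D w∈C

      uD : Unique D
      uD = Unique-filter⁺ (λ w → ¬? (w ∈? C)) uS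

      f-∉ : ∀ {w} → w ∈ ps ++ [ g ] → w ≢ f
      f-∉ w∈ refl = Unique[x∷xs]⇒x∉xs unique w∈

      ∈-ps : ∀ {w} → w ∈ ps → w ∈ ps ++ [ g ]
      ∈-ps = ∈-++⁺ˡ

      g∈ : g ∈ ps ++ [ g ]
      g∈ = ∈-++⁺ʳ ps (here refl)

      unique-ps : Unique (ps ++ [ g ])
      unique-ps with _ ∷ u ← unique = u

      unique-pqg : Unique (p ∷ q ∷ g ∷ [])
      unique-pqg with (p≢q ∷ p≢) ∷ q≢ ∷ _ ← unique-ps =
        (p≢q ∷ All.lookup p≢ g∈rest ∷ []) ∷ (All.lookup q≢ g∈rest ∷ []) ∷ [] ∷ []
        where
        g∈rest : g ∈ rest ++ [ g ]
        g∈rest = ∈-++⁺ʳ rest (here refl)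

      room-f : 3 + length (neighbours f D) ≤ N
      room-f = ≤-trans
        (neighbours-+ (p ∷ q ∷ g ∷ []) unique-pqg uD D⊆S λ where
          (here refl)                 → member (∈-ps (here refl)) f-p
          (there (here refl))         → member (∈-ps (there (here refl))) f-q
          (there (there (here refl))) → member g∈ f-g)
        (small (here refl))
        where
        member : ∀ {w} → w ∈ ps ++ [ g ] → Meets f w → w ∈ S × w ∉ D × Adjacent f w
        member w∈ fMw = ⊆S (there w∈) , C-∉D (there w∈) , f-∉ w∈ , fMw

      room-g : 2 + length (neighbours g D) ≤ N
      room-g = ≤-trans
        (neighbours-+ (f ∷ ℓ ∷ []) ((f-∉ (∈-ps ℓ∈) ∘ sym ∷ []) ∷ [] ∷ []) uD D⊆S λ where
          (here refl)         → ⊆S (here refl) , C-∉D (here refl) , f-∉ g∈ ∘ sym , meets-sym f-g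
          (there (here refl)) → ⊆S (there (∈-ps ℓ∈)) , C-∉D (there (∈-ps ℓ∈))
                              , (λ where refl → ∉-initial ps unique-ps ℓ∈) , g-ℓ)
        (small (there g∈))

      cover : S ⊆ g ∷ ps ++ f ∷ D
      cover {w} w∈S with w ∈? C
      ... | no w∉C          = there (∈-++⁺ʳ ps (there (∈-filter⁺ (λ w → ¬? (w ∈? C)) w∈S w∉C)))
      ... | yes (here refl) = there (∈-++⁺ʳ ps (here refl))
      ... | yes (there w∈) with ∈-++⁻ ps w∈
      ... | inj₁ q∈          = there (∈-++⁺ˡ q∈)
      ... | inj₂ (here refl) = here refl

      -- When `g` is coloured last, its neighbours are `f`, `ℓ` and members of `D`. The colours of
      -- the latter were listed under the earlier map `c`, with which `c₂` agrees on `D`.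
      colour-last : ∀ {c c₂ c-f a} → Proper c₂ (ps ++ f ∷ D) → c₂ f ≡ c-f → (∀ {w} → w ∈ D → c₂ w ≡ c w) →
                    a ∉ c-f ∷ c₂ ℓ ∷ map c (neighbours g D) → ∃ λ c₃ → Proper c₃ S
      colour-last {c} {c₂} {c-f} {a} pr₂ c₂f same a∉ =
        let c₃ , pr₃ , _ = proper-extend {c₂} {v = g} {a} pr₂ g∉ free in c₃ , proper-⊆ cover pr₃
        where
        g∉ : g ∉ ps ++ f ∷ D
        g∉ g∈′ with ∈-++⁻ ps g∈′
        ... | inj₁ g∈ps        = ∉-initial ps unique-ps g∈ps
        ... | inj₂ (here g≡f)  = f-∉ g∈ g≡f
        ... | inj₂ (there g∈D) = C-∉D (there g∈) g∈D
        free : ∀ {w} → w ∈ ps ++ f ∷ D → Meets g w → c₂ w ≢ a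
        free w∈ gMw c₂w≡a with ∈-++⁻ ps w∈
        ... | inj₁ w∈ps with refl ← g-only-ℓ w∈ps gMw = a∉ (there (here (sym c₂w≡a)))
        ... | inj₂ (here refl) = a∉ (here (trans (sym c₂w≡a) c₂f))
        ... | inj₂ (there w∈D) = a∉ (there (there (subst (_∈ _) (trans (sym (same w∈D)) c₂w≡a)
                (∈-map⁺ c (∈-filter⁺ (adjacent? g) w∈D ((λ where refl → C-∉D (there g∈) w∈D) , gMw))))))

    configuration-extend : ∀ {c} → Proper c D → ∃ λ c′ → Proper c′ S
    configuration-extend {c} pr =
      -- The order is `f`, then the walk, then `g`. The colour of `f` is fixed before that of `ℓ` is
      -- known, so `rescue` has to work for every colour of `ℓ`.
      let c-f , c-f∉ , rescue = fresh-pair (map c (neighbours f D)) (map c (neighbours g D))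
             (subst (λ n → 3 + n ≤ N) (sym (length-map c (neighbours f D))) room-f)
             (subst (λ n → 2 + n ≤ N) (sym (length-map c (neighbours g D))) room-g)
          c₁ , pr₁ , c₁f , same₁ = proper-extend {c} pr (C-∉D (here refl)) (colour-∉ {c} (C-∉D (here refl)) c-f∉)
          c₂ , pr₂ , same₂ = colour-walk {S} {f ∷ D} {c₁} ps linked unique-ps (⊆S ∘ there)
             disjoint uf∷D f∷D⊆S (small ∘ there ∘ ∈-ps) pr₁
          a , a∉ = rescue (c₂ ℓ)
      in colour-last {c} {c₂} {c-f} {a} pr₂ (trans (same₂ (here refl)) c₁f)
                     (λ w∈D → trans (same₂ (there w∈D)) (same₁ w∈D)) a∉
      where
      disjoint : ∀ {w} → w ∈ ps ++ [ g ] → w ∉ f ∷ D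
      disjoint w∈ (here refl) = f-∉ w∈ refl
      disjoint w∈ (there w∈D) = C-∉D (there w∈) w∈D
      uf∷D : Unique (f ∷ D)
      uf∷D = All.tabulate (λ w∈D → λ where refl → C-∉D (here refl) w∈D) ∷ uD
      f∷D⊆S : f ∷ D ⊆ S
      f∷D⊆S (here refl) = ⊆S (here refl)
      f∷D⊆S (there w∈D) = D⊆S w∈D

-- Double counting of related pairs

filter-map : ∀ {A B : Set} {P : B → Set} (P? : ∀ y → Dec (P y)) (f : A → B) xs →
             filter P? (map f xs) ≡ map f (filter (P? ∘ f) xs)
filter-map P? f []       = refl
filter-map P? f (x ∷ xs) with does (P? (f x))
... | true  = cong (f x ∷_) (filter-map P? f xs)
... | false = filter-map P? f xs

sum-map-mono : ∀ {A : Set} {h k : A → ℕ} xs → (∀ {x} → x ∈ xs → h x ≤ k x) → sum (map h xs) ≤ sum (map k xs)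
sum-map-mono []       _   = z≤n
sum-map-mono (x ∷ xs) h≤k = +-mono-≤ (h≤k (here refl)) (sum-map-mono xs (h≤k ∘ there))

sum-map-filter : ∀ {A : Set} {P : A → Set} (P? : ∀ x → Dec (P x)) {h k : A → ℕ} xs →
                 (∀ {x} → P x → h x ≤ k x) → sum (map h (filter P? xs)) ≤ sum (map k xs)
sum-map-filter P? []       _   = z≤n
sum-map-filter P? {k = k} (x ∷ xs) h≤k with P? x
... | yes px = +-mono-≤ (h≤k px) (sum-map-filter P? xs h≤k)
... | no  _  = ≤-trans (sum-map-filter P? xs h≤k) (m≤n+m _ (k x))

module _ {A B : Set} {R : A → B → Set} (R? : ∀ x y → Dec (R x y)) where

  sum-map-filter-∷ : ∀ xs y ys →
    sum (map (λ x → length (filter (R? x) (y ∷ ys))) xs) ≡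
    length (filter (λ x → R? x y) xs) + sum (map (λ x → length (filter (R? x) ys)) xs)
  sum-map-filter-∷ []       y ys = refl
  sum-map-filter-∷ (x ∷ xs) y ys with ih ← sum-map-filter-∷ xs y ys | does (R? x y)
  ... | true  = cong suc (trans (cong (length (filter (R? x) ys) +_) ih)
                  (x∙yz≈y∙xz +-commutativeSemigroup (length (filter (R? x) ys)) (length (filter (λ x → R? x y) xs)) _))
  ... | false = trans (cong (length (filter (R? x) ys) +_) ih)
                  (x∙yz≈y∙xz +-commutativeSemigroup (length (filter (R? x) ys)) (length (filter (λ x → R? x y) xs)) _)

  -- Both sides count the pairs related by `R`; `sum-map-filter-∷` splits off the pairs with second
  -- entry `y`.
  double-count : ∀ xs ys → sum (map (λ x → length (filter (R? x) ys)) xs) ≡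
                           sum (map (λ y → length (filter (λ x → R? x y) xs)) ys)
  double-count []       []       = refl
  double-count (x ∷ xs) []       = double-count xs []
  double-count xs       (y ∷ ys) =
    trans (sum-map-filter-∷ xs y ys) (cong (length (filter (λ x → R? x y) xs) +_) (double-count xs ys))

-- Subsets as lists of points

points : ∀ {n} → Subset n → List (Fin n)
points p = filter (_∈ₛ? p) (allFin _)

∈-points⁺ : ∀ {n} {p : Subset n} {x} → x ∈ₛ p → x ∈ points p
∈-points⁺ {p = p} {x} = ∈-filter⁺ (_∈ₛ? p) (∈-allFin x)

∈-points⁻ : ∀ {n} {p : Subset n} {x} → x ∈ points p → x ∈ₛ p
∈-points⁻ {p = p} = proj₂ ∘ ∈-filter⁻ (_∈ₛ? p) {xs = allFin _}

points-unique : ∀ {n} (p : Subset n) → Unique (points p)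
points-unique p = Unique-filter⁺ (_∈ₛ? p) (allFin⁺ _)

length-points : ∀ {n} (p : Subset n) → length (points p) ≡ ∣ p ∣
length-points []      = refl
length-points {suc n} (s ∷ p) = count-head s
  where
  open ≡-Reasoning
  count-tail : ∀ s → length (filter (_∈ₛ? (s ∷ p)) (tabulate suc)) ≡ ∣ p ∣
  count-tail s = begin
    length (filter (_∈ₛ? (s ∷ p)) (tabulate suc))
      ≡⟨ cong (length ∘ filter (_∈ₛ? (s ∷ p))) (map-tabulate id suc) ⟨
    length (filter (_∈ₛ? (s ∷ p)) (map suc (allFin n)))
      ≡⟨ cong length (filter-map (_∈ₛ? (s ∷ p)) suc (allFin n)) ⟩
    length (map suc (filter ((_∈ₛ? (s ∷ p)) ∘ suc) (allFin n)))
      ≡⟨ length-map suc (filter ((_∈ₛ? (s ∷ p)) ∘ suc) (allFin n)) ⟩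
    length (filter ((_∈ₛ? (s ∷ p)) ∘ suc) (allFin n))
      ≡⟨ cong length (filter-≐ ((_∈ₛ? (s ∷ p)) ∘ suc) (_∈ₛ? p) (drop-there , thereᵥ) (allFin n)) ⟩
    length (points p)
      ≡⟨ length-points p ⟩
    ∣ p ∣ ∎
  count-head : ∀ s → length (points (s ∷ p)) ≡ ∣ s ∷ p ∣
  count-head inside  = cong suc (count-tail inside)
  count-head outside = count-tail outside

∣p∣≥1 : ∀ {n} {p : Subset n} → Nonempty p → 1 ≤ ∣ p ∣
∣p∣≥1 {p = p} (x , x∈p) = subst (1 ≤_) (length-points p)
  (length-⊆ {xs = [ x ]} ([] ∷ []) λ where (here refl) → ∈-points⁺ x∈p)

-- Degrees in the hypergraph and in its 2-section

module _ (H : Hypergraph) where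

  map-verts-allFin : map (verts H) (allFin (length (E H))) ≡ E H
  map-verts-allFin = trans (map-tabulate id (verts H)) (tabulate-lookup (E H))

  through : Vertex H → List (Edge H) → List (Edge H)
  through x = filter (λ f → x ∈ₛ? verts H f)

  -- Hyperedges in `S` are positions in `E H`, while degrees filter the subsets themselves. So `S`
  -- is enlarged to all positions, which `verts` carries onto `E H`.
  sum-through-≤ : ∀ (h : Subset (order H) → ℕ) x {S} → Unique S →
    sum (map (h ∘ verts H) (through x S)) ≤ sum (map h (filter (x ∈ₛ?_) (E H)))
  sum-through-≤ h x {S} uS = begin
    sum (map (h ∘ verts H) (through x S))
      ≤⟨ sum-map-⊆ (h ∘ verts H) (Unique-filter⁺ (λ f → x ∈ₛ? verts H f) uS)
           (λ f∈ → ∈-filter⁺ (λ f → x ∈ₛ? verts H f) (∈-allFin _) (proj₂ (∈-filter⁻ (λ f → x ∈ₛ? verts H f) {xs = S} f∈))) ⟩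
    sum (map (h ∘ verts H) (through x (allFin _)))
      ≡⟨ cong sum (map-∘ (through x (allFin _))) ⟩
    sum (map h (map (verts H) (through x (allFin _))))
      ≡⟨ cong (sum ∘ map h) (filter-map (x ∈ₛ?_) (verts H) (allFin _)) ⟨
    sum (map h (filter (x ∈ₛ?_) (map (verts H) (allFin _))))
      ≡⟨ cong (sum ∘ map h ∘ filter (x ∈ₛ?_)) map-verts-allFin ⟩
    sum (map h (filter (x ∈ₛ?_) (E H))) ∎
    where open ≤-Reasoning

  length-through-≤Δ : ∀ x {S} → Unique S → length (through x S) ≤ Δ H
  length-through-≤Δ x {S} uS = begin
    length (through x S)                              ≡⟨ sum-map-const-1 (through x S) ⟨
    sum (map (const 1) (through x S))                 ≤⟨ sum-through-≤ (const 1) x uS ⟩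
    sum (map (const 1) (filter (x ∈ₛ?_) (E H)))       ≡⟨ sum-map-const-1 (filter (x ∈ₛ?_) (E H)) ⟩
    deg H x                                           ≤⟨ All.lookup (xs≤max 0 (tabulate (deg H))) (∈-tabulate⁺ x) ⟩
    Δ H                                               ∎
    where open ≤-Reasoning

  sectionMult-≢ : ∀ {x y} → y ≢ x → sectionMult H x y ≡ codeg H x y
  sectionMult-≢ {x} {y} y≢x with x ≟ᶠ y
  ... | yes x≡y = contradiction (sym x≡y) y≢x
  ... | no  _   = refl

  -- Double counting of the pairs of a hyperedge `e` through `x` and a further vertex `y` of `e`:
  -- grouped by `y` they give the codegrees, grouped by `e` the sizes less one.
  sum-sizes-≤mdeg : ∀ x → sum (map (λ e → ∣ e ∣ ∸ 1) (filter (x ∈ₛ?_) (E H))) ≤ mdeg (2-section H) x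
  sum-sizes-≤mdeg x = begin
    sum (map (λ e → ∣ e ∣ ∸ 1) (filter (x ∈ₛ?_) (E H)))
      ≤⟨ sum-map-filter (x ∈ₛ?_) (E H) size-≤ ⟩
    sum (map (λ e → length (filter (λ y → both? y e) ys)) (E H))
      ≡⟨ double-count both? ys (E H) ⟨
    sum (map (codeg H x) ys)
      ≤⟨ sum-map-mono ys (λ y∈ → ≤-reflexive (sym (sectionMult-≢ (proj₂ (∈-filter⁻ ≢x? {xs = allFin _} y∈))))) ⟩
    sum (map (sectionMult H x) ys)
      ≤⟨ sum-map-⊆ (sectionMult H x) ys-unique (λ _ → ∈-allFin _) ⟩
    sum (map (sectionMult H x) (allFin _))
      ≡⟨ cong sum (map-tabulate id (sectionMult H x)) ⟩
    mdeg (2-section H) x ∎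
    where
    open ≤-Reasoning
    ≢x? : ∀ y → Dec (y ≢ x)
    ≢x? y = ¬? (y ≟ᶠ x)
    ys : List (Vertex H)
    ys = filter ≢x? (allFin _)
    ys-unique : Unique ys
    ys-unique = Unique-filter⁺ ≢x? (allFin⁺ _)
    both? : ∀ y e → Dec (x ∈ₛ e × y ∈ₛ e)
    both? y e = (x ∈ₛ? e) ×-dec (y ∈ₛ? e)
    size-≤ : ∀ {e} → x ∈ₛ e → ∣ e ∣ ∸ 1 ≤ length (filter (λ y → both? y e) ys)
    size-≤ {e} x∈e = ∸-monoˡ-≤ {∣ e ∣} {suc (length (filter (λ y → both? y e) ys))} 1
      (≤-trans (≤-reflexive (sym (length-points e))) (length-⊆ (points-unique e) incl))
      where
      incl : points e ⊆ x ∷ filter (λ y → both? y e) ys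
      incl {y} y∈ with y ≟ᶠ x
      ... | yes refl = here refl
      ... | no y≢x   = there (∈-filter⁺ (λ y → both? y e) (∈-filter⁺ ≢x? (∈-allFin y) y≢x) (x∈e , ∈-points⁻ y∈))

  size : Edge H → ℕ
  size f = ∣ verts H f ∣

  sum-sizes-≤mΔ : ∀ x {S} → Unique S → sum (map (λ f → size f ∸ 1) (through x S)) ≤ mΔ (2-section H)
  sum-sizes-≤mΔ x uS = ≤-trans (sum-through-≤ (λ e → ∣ e ∣ ∸ 1) x uS) (≤-trans (sum-sizes-≤mdeg x)
    (All.lookup (xs≤max 0 (tabulate (mdeg (2-section H)))) (∈-tabulate⁺ x)))

-- Arithmetic of the extremal case

-- For `t < k` the product `k * t` is at most `suc t * (k ∸ 1)`, hence at most `D`; for `t > k` it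
-- is smaller than `t * t`. Only `t ≡ k` can attain `D + 1`.
k*t-bound : ∀ {D t} k → suc t * (k ∸ 1) ≤ D → t * t ≤ D + 1 → k * t < D + 1 ⊎ (t ≡ k × k * t ≤ D + 1)
k*t-bound zero _ _ = inj₁ (m≤n+m _ _)
k*t-bound {D} {t} (suc j) st*j≤D t*t≤ with <-cmp t (suc j)
... | tri< (s≤s t≤j) _ _ = inj₁ (subst (suc j * t <_) (+-comm 1 D) (s≤s (begin
    t + j * t  ≤⟨ +-monoˡ-≤ (j * t) t≤j ⟩
    j + j * t  ≡⟨ *-suc j t ⟨
    j * suc t  ≡⟨ *-comm j (suc t) ⟩
    suc t * j  ≤⟨ st*j≤D ⟩
    D          ∎)))
  where open ≤-Reasoning
... | tri≈ _ refl _ = inj₂ (refl , t*t≤)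
... | tri> _ _ j<t@(s≤s _) = inj₁ (<-≤-trans (*-monoˡ-< t j<t) t*t≤)

pred-* : ∀ k → 1 ≤ k → suc (suc k * (k ∸ 1)) ≡ k * k
pred-* (suc j) _ = identity j
  where
  identity : ∀ j → suc (suc (suc j) * j) ≡ suc j * suc j
  identity = solve-∀

-- The line graph of the hypergraph

module _ (H : Hypergraph) where

  Meets : Edge H → Edge H → Set
  Meets e f = ∃ λ x → x ∈ₛ verts H e × x ∈ₛ verts H f

  meets? : ∀ e f → Dec (Meets e f)
  meets? e f = any? λ x → (x ∈ₛ? verts H e) ×-dec (x ∈ₛ? verts H f)

  meets-sym : ∀ {e f} → Meets e f → Meets f e
  meets-sym (x , x∈e , x∈f) = x , x∈f , x∈e

  size≥2 : Loopless H → ∀ e → 2 ≤ size H e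
  size≥2 loopless e = ≤∧≢⇒< (∣p∣≥1 (All.lookup (edge-nonempty H) (∈-lookup e)))
                             (All.lookup loopless (∈-lookup e) ∘ sym)

  module _ (loopless : Loopless H) (Δ-bound : Δ H ≤√ (mΔ (2-section H) + 1) +1) where

    N : ℕ
    N = mΔ (2-section H) + 1

    open Colouring Meets meets? (λ {e f} → meets-sym {e} {f}) N

    -- Counting around a smallest hyperedge without room for greedy colouring

    module Smallest {S} (uS : Unique S) {e} (e∈S : e ∈ S) (heavy : N ≤ length (neighbours e S))
                    (minimal : ∀ {f} → f ∈ S → size H e ≤ size H f) where
      private
        k : ℕ
        k = size H e

      others? : ∀ x f → Dec (f ≢ e × x ∈ₛ verts H f)
      others? x f = ¬? (f ≟ᶠ e) ×-dec (x ∈ₛ? verts H f)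

      others : Vertex H → List (Edge H)
      others x = filter (others? x) S

      t : Vertex H → ℕ
      t = length ∘ others

      suc-t≤ : ∀ {x} → x ∈ₛ verts H e → suc (t x) ≤ length (through H x S)
      suc-t≤ {x} x∈e = length-⊆ {xs = e ∷ others x}
        (All.tabulate (λ f∈ → λ where refl → proj₁ (proj₂ (∈-filter⁻ (others? x) {xs = S} f∈)) refl)
          ∷ Unique-filter⁺ (others? x) uS)
        λ where
          (here refl) → ∈-filter⁺ (λ f → x ∈ₛ? verts H f) e∈S x∈e
          (there f∈)  → let f∈S , _ , x∈f = ∈-filter⁻ (others? x) {xs = S} f∈ in
                        ∈-filter⁺ (λ f → x ∈ₛ? verts H f) f∈S x∈f

      through-size≥ : ∀ {x f} → f ∈ through H x S → k ∸ 1 ≤ size H f ∸ 1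
      through-size≥ {x} f∈ = ∸-monoˡ-≤ 1 (minimal (proj₁ (∈-filter⁻ (λ f → x ∈ₛ? verts H f) {xs = S} f∈)))

      -- Each hyperedge of `S` through `x` adds at least `k ∸ 1` to the degree of `x` in the
      -- 2-section.
      suc-t*-≤ : ∀ {x} → x ∈ₛ verts H e → suc (t x) * (k ∸ 1) ≤ mΔ (2-section H)
      suc-t*-≤ {x} x∈e = begin
        suc (t x) * (k ∸ 1)                             ≤⟨ *-monoˡ-≤ (k ∸ 1) (suc-t≤ x∈e) ⟩
        length (through H x S) * (k ∸ 1)                ≤⟨ sum-map-≥ (λ f → size H f ∸ 1) (through H x S) (through-size≥ {x}) ⟩
        sum (map (λ f → size H f ∸ 1) (through H x S))  ≤⟨ sum-sizes-≤mΔ H x uS ⟩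
        mΔ (2-section H)                                ∎
        where open ≤-Reasoning

      -- `e` itself passes through `x`, which leaves at most `Δ H ∸ 1` other hyperedges there;
      -- `Δ-bound` limits the square of that number.
      t*t≤N : ∀ {x} → x ∈ₛ verts H e → t x * t x ≤ N
      t*t≤N {x} x∈e = ≤-trans (*-mono-≤ t≤ t≤) Δ-bound
        where
        t≤ : t x ≤ Δ H ∸ 1
        t≤ = ∸-monoˡ-≤ {suc (t x)} 1 (≤-trans (suc-t≤ x∈e) (length-through-≤Δ H x uS))

      k*t-dichotomy : ∀ {x} → x ∈ₛ verts H e → k * t x < N ⊎ (t x ≡ k × k * t x ≤ N)
      k*t-dichotomy x∈e = k*t-bound k (suc-t*-≤ x∈e) (t*t≤N x∈e)

      k*t≤N : ∀ {x} → x ∈ₛ verts H e → k * t x ≤ N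
      k*t≤N x∈e with k*t-dichotomy x∈e
      ... | inj₁ k*t<N       = <⇒≤ k*t<N
      ... | inj₂ (_ , k*t≤N) = k*t≤N

      P : List (Vertex H)
      P = points (verts H e)

      ∣P∣ : length P ≡ k
      ∣P∣ = length-points (verts H e)

      neighbours-cover : ∀ Q → (∀ {f} → f ∈ S → Adjacent e f → ∃ λ x → x ∈ Q × x ∈ₛ verts H f) →
                         length (neighbours e S) ≤ sum (map t Q)
      neighbours-cover Q cover = length-cover others (Unique-filter⁺ (adjacent? e) uS) λ f∈ →
        let f∈S , f≢e , eMf = ∈-filter⁻ (adjacent? e) f∈
            x , x∈Q , x∈f   = cover f∈S (f≢e , eMf)
        in x , x∈Q , ∈-filter⁺ (others? x) f∈S (f≢e , x∈f)

      neighbours≤sum : length (neighbours e S) ≤ sum (map t P)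
      neighbours≤sum = neighbours-cover P λ _ (_ , x , x∈e , x∈f) → x , ∈-points⁺ x∈e , x∈f

      -- The `k` points of `e` together carry at least `N` neighbours, so the `k` terms `k * t x`
      -- sum to at least `k * N`. None of them exceeds `N`, so none can be smaller.
      t≡k : ∀ {x} → x ∈ₛ verts H e → t x ≡ k
      t≡k {x} x∈e with k*t-dichotomy x∈e
      ... | inj₂ (t≡k , _) = t≡k
      ... | inj₁ k*t<N = contradiction
        (begin
          k * N                        ≤⟨ *-monoʳ-≤ k (≤-trans heavy neighbours≤sum) ⟩
          k * sum (map t P)            ≡⟨ sum-map-*ˡ t k P ⟨
          sum (map (λ x → k * t x) P)  ∎)
        (<⇒≱ (subst (λ n → sum (map (λ x → k * t x) P) < n * N) ∣P∣
          (sum-map-< (λ x → k * t x) P (λ y∈ → k*t≤N (∈-points⁻ y∈)) (∈-points⁺ x∈e) k*t<N)))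
        where open ≤-Reasoning

      sum-t≤ : ∀ Q → Q ⊆ P → sum (map t Q) ≤ length Q * k
      sum-t≤ Q Q⊆P = sum-map-≤ t Q λ x∈ → ≤-reflexive (t≡k (∈-points⁻ (Q⊆P x∈)))

      neighbours≤k*k : length (neighbours e S) ≤ k * k
      neighbours≤k*k = ≤-trans neighbours≤sum (subst (λ n → sum (map t P) ≤ n * k) ∣P∣ (sum-t≤ P id))

      -- One inequality is `k*t≤N` at any point of `e`; the other holds because `k` points with `k`
      -- other hyperedges each must yield the `N` neighbours.
      k*k≡N : k * k ≡ N
      k*k≡N with x , x∈e ← All.lookup (edge-nonempty H) (∈-lookup e) = ≤-antisym
        (subst (λ n → k * n ≤ N) (t≡k x∈e) (k*t≤N x∈e)) (≤-trans heavy neighbours≤k*k)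

      neighbours≤N : length (neighbours e S) ≤ N
      neighbours≤N = ≤-trans neighbours≤k*k (≤-reflexive k*k≡N)

      1≤k : 1 ≤ k
      1≤k = ≤-trans (s≤s z≤n) (size≥2 loopless e)

      through-length : ∀ {x} → x ∈ₛ verts H e → suc k ≤ length (through H x S)
      through-length x∈e = subst (λ n → suc n ≤ _) (t≡k x∈e) (suc-t≤ x∈e)

      -- At least `k + 1` hyperedges pass through `x`. If all have size `k`, they already use up the
      -- degree bound `N - 1`, since `(k + 1) * (k - 1)` is `k * k - 1`; a larger one would exceed
      -- it.
      through-size : ∀ {x f} → x ∈ₛ verts H e → f ∈ S → x ∈ₛ verts H f → size H f ≡ k
      through-size {x} {f} x∈e f∈S x∈f with m≤n⇒m<n∨m≡n (minimal f∈S)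
      ... | inj₂ k≡  = sym k≡
      ... | inj₁ k<f = contradiction
        (begin
          N                                                     ≡⟨ k*k≡N ⟨
          k * k                                                 ≡⟨ pred-* k 1≤k ⟨
          suc (suc k * (k ∸ 1))                                 ≤⟨ s≤s (*-monoˡ-≤ (k ∸ 1) (through-length x∈e)) ⟩
          suc (length (through H x S) * (k ∸ 1))                ≤⟨ sum-map-> (λ f → size H f ∸ 1) (through H x S) (through-size≥ {x})
                                                                     (∈-filter⁺ (λ f → x ∈ₛ? verts H f) f∈S x∈f) (∸-monoˡ-< k<f 1≤k) ⟩
          sum (map (λ f → size H f ∸ 1) (through H x S))        ≤⟨ sum-sizes-≤mΔ H x uS ⟩
          mΔ (2-section H)                                      ∎)
        (<⇒≱ (≤-reflexive (+-comm 1 (mΔ (2-section H)))))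
        where open ≤-Reasoning

      -- A hyperedge sharing two points with `e` would be counted twice among the `k * k`
      -- incidences, leaving fewer than `N` neighbours.
      linear : ∀ {f x y} → f ∈ S → f ≢ e → x ∈ₛ verts H e → x ∈ₛ verts H f → y ∈ₛ verts H e → y ∈ₛ verts H f → x ≡ y
      linear {f} {x} {y} f∈S f≢e x∈e x∈f y∈e y∈f with x ≟ᶠ y
      ... | yes x≡y = x≡y
      ... | no x≢y = contradiction
        (begin
          N                           ≤⟨ heavy ⟩
          length (neighbours e S)     ≤⟨ length-cover L (Unique-filter⁺ (adjacent? e) uS) cover ⟩
          sum (map (length ∘ L) P)    ∎)
        (<⇒≱ (subst (sum (map (length ∘ L) P) <_) (trans (cong (_* k) ∣P∣) k*k≡N)
          (sum-map-< (length ∘ L) P L≤k (∈-points⁺ x∈e) Lx<k)))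
        where
        open ≤-Reasoning
        -- f is counted at y only.
        keep? : ∀ z h → Dec (¬ (z ≡ x × h ≡ f))
        keep? z h = ¬? ((z ≟ᶠ x) ×-dec (h ≟ᶠ f))
        L : Vertex H → List (Edge H)
        L z = filter (keep? z) (others z)
        L≤k : ∀ {z} → z ∈ P → length (L z) ≤ k
        L≤k {z} z∈ = ≤-trans (length-filter (keep? z) (others z)) (≤-reflexive (t≡k (∈-points⁻ z∈)))
        Lx<k : length (L x) < k
        Lx<k = subst (length (L x) <_) (t≡k x∈e) (length-⊆ {xs = f ∷ L x}
          (All.tabulate (λ h∈ → λ where refl → proj₂ (∈-filter⁻ (keep? x) {xs = others x} h∈) (refl , refl))
            ∷ Unique-filter⁺ (keep? x) (Unique-filter⁺ (others? x) uS))
          λ where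
            (here refl) → ∈-filter⁺ (others? x) f∈S (f≢e , x∈f)
            (there h∈)  → proj₁ (∈-filter⁻ (keep? x) h∈))
        cover : ∀ {h} → h ∈ neighbours e S → ∃ λ z → z ∈ P × h ∈ L z
        cover {h} h∈ with ∈-filter⁻ (adjacent? e) {xs = S} h∈ | h ≟ᶠ f
        ... | h∈S , h≢e , _ | yes refl = y , ∈-points⁺ y∈e ,
          ∈-filter⁺ (keep? y) (∈-filter⁺ (others? y) h∈S (h≢e , y∈f)) λ (y≡x , _) → x≢y (sym y≡x)
        ... | h∈S , h≢e , z , z∈e , z∈h | no h≢f = z , ∈-points⁺ z∈e ,
          ∈-filter⁺ (keep? z) (∈-filter⁺ (others? z) h∈S (h≢e , z∈h)) λ (_ , h≡f) → h≢f h≡f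

    -- Smallest hyperedges when no greedy step is possible

    module Heavy {S} (uS : Unique S) (heavy : ∀ {e} → e ∈ S → N ≤ length (neighbours e S))
                 (k : ℕ) (k≤size : ∀ {f} → f ∈ S → k ≤ size H f) where

      Low : Edge H → Set
      Low e = e ∈ S × size H e ≡ k

      2≤k : ∀ {e} → Low e → 2 ≤ k
      2≤k {e} low = subst (2 ≤_) (proj₂ low) (size≥2 loopless e)

      module At {e} (low : Low e) =
        Smallest uS (proj₁ low) (heavy (proj₁ low))
                 (λ f∈S → ≤-trans (≤-reflexive (proj₂ low)) (k≤size f∈S))

      -- Walks that start at a smallest hyperedge stay among the smallest ones, so the counts of
      -- `Smallest` hold all along them.
      low-neighbour : ∀ {e f x} → Low e → f ∈ S → x ∈ₛ verts H e → x ∈ₛ verts H f → Low f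
      low-neighbour low f∈S x∈e x∈f = f∈S , trans (At.through-size low x∈e f∈S x∈f) (proj₂ low)

      low-linear : ∀ {e f x y} → Low e → f ∈ S → x ∈ₛ verts H e → x ∈ₛ verts H f →
                   y ∈ₛ verts H e → y ∈ₛ verts H f → x ≢ y → f ≡ e
      low-linear {e} {f} low f∈S x∈e x∈f y∈e y∈f x≢y = decidable-stable (f ≟ᶠ e)
        λ f≢e → x≢y (At.linear low f∈S f≢e x∈e x∈f y∈e y∈f)

      through-length≥ : ∀ {e x} → Low e → x ∈ₛ verts H e → suc k ≤ length (through H x S)
      through-length≥ low x∈e = subst (λ n → suc n ≤ _) (proj₂ low) (At.through-length low x∈e)

      ∈-through⁻ : ∀ {x f} → f ∈ through H x S → f ∈ S × x ∈ₛ verts H f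
      ∈-through⁻ {x} = ∈-filter⁻ (λ f → x ∈ₛ? verts H f) {xs = S}

      through-unique : ∀ x → Unique (through H x S)
      through-unique x = Unique-filter⁺ (λ f → x ∈ₛ? verts H f) uS

      -- The k + 1 edges through x would have to meet e in distinct points, but e has only k.
      missing-edge : ∀ {e f x} → Low e → Low f → x ∈ₛ verts H f → x ∉ₛ verts H e →
                     ∃ λ g → Low g × x ∈ₛ verts H g × ¬ Meets e g
      missing-edge {e} {f} {x} low-e low-f x∈f x∉e with Any.any? (λ g → ¬? (meets? e g)) (through H x S)
      ... | yes p with g , g∈ , ¬eMg ← find p = let g∈S , x∈g = ∈-through⁻ g∈ in
        g , low-neighbour low-f g∈S x∈f x∈g , x∈g , ¬eMg
      ... | no ¬p = contradiction
        (begin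
          suc k                            ≤⟨ through-length≥ low-f x∈f ⟩
          length (through H x S)           ≤⟨ length-cover L (through-unique x) cover ⟩
          sum (map (length ∘ L) (points (verts H e))) ≤⟨ sum-map-≤ (length ∘ L) (points (verts H e)) (λ y∈ → L≤1 (∈-points⁻ y∈)) ⟩
          length (points (verts H e)) * 1  ≡⟨ *-identityʳ _ ⟩
          length (points (verts H e))      ≡⟨ length-points (verts H e) ⟩
          size H e                         ≡⟨ proj₂ low-e ⟩
          k                                ∎)
        (<⇒≱ ≤-refl)
        where
        open ≤-Reasoning
        through? : ∀ y g → Dec (y ∈ₛ verts H g)
        through? y g = y ∈ₛ? verts H g
        L : Vertex H → List (Edge H)
        L y = filter (through? y) (through H x S)
        cover : ∀ {g} → g ∈ through H x S → ∃ λ y → y ∈ points (verts H e) × g ∈ L y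
        cover {g} g∈ with meets? e g
        ... | yes (y , y∈e , y∈g) = y , ∈-points⁺ y∈e , ∈-filter⁺ (through? y) g∈ y∈g
        ... | no ¬eMg = contradiction (lose g∈ ¬eMg) ¬p
        -- Two hyperedges through both `x` and `y` coincide by linearity, as `x` is not on `e`.
        L≤1 : ∀ {y} → y ∈ₛ verts H e → length (L y) ≤ 1
        L≤1 {y} y∈e = length-singleton (Unique-filter⁺ (through? y) (through-unique x)) λ g∈ h∈ →
          let g∈x , y∈g = ∈-filter⁻ (through? y) {xs = through H x S} g∈
              h∈x , y∈h = ∈-filter⁻ (through? y) {xs = through H x S} h∈
              g∈S , x∈g = ∈-through⁻ g∈x
              h∈S , x∈h = ∈-through⁻ h∈x
          in sym (low-linear (low-neighbour low-f g∈S x∈f x∈g) h∈S x∈g x∈h y∈g y∈h λ where refl → x∉e y∈e)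

      low-small : ∀ {e} → Low e → length (neighbours e S) ≤ N
      low-small low = At.neighbours≤N low

      meets-≢ : ∀ {e f g} → Meets e f → ¬ Meets e g → f ≢ g
      meets-≢ eMf ¬eMg refl = ¬eMg eMf

      ∈∉-≢ : ∀ {e f x} → x ∈ₛ verts H e → x ∉ₛ verts H f → e ≢ f
      ∈∉-≢ x∈e x∉f refl = x∉f x∈e

      -- A hyperedge `d` through the corner `x` misses the opposite side `a`. The walk is `d`, `c`,
      -- `a`; `b` meets all of it, and `a` meets `c` but not `d`.
      triangle-configuration : ∀ {a b c x} → Low a → Low b → Low c → b ≢ c → x ∈ₛ verts H b → x ∈ₛ verts H c →
        x ∉ₛ verts H a → Meets a b → Meets a c → Configuration S
      triangle-configuration {a} {b} {c} {x} low-a low-b low-c b≢c x∈b x∈c x∉a aMb aMc =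
        let d , low-d , x∈d , ¬aMd = missing-edge low-a low-b x∈b x∉a
            all-low : All Low (b ∷ d ∷ c ∷ a ∷ [])
            all-low = low-b ∷ low-d ∷ low-c ∷ low-a ∷ []
        in record
        { f = b ; p = d ; q = c ; g = a ; ℓ = c ; rest = []
        ; unique = (meets-≢ aMb ¬aMd ∷ b≢c ∷ ∈∉-≢ x∈b x∉a ∷ [])
                 ∷ (meets-≢ aMc ¬aMd ∘ sym ∷ ∈∉-≢ x∈d x∉a ∷ [])
                 ∷ (∈∉-≢ x∈c x∉a ∷ []) ∷ [] ∷ []
        ; ⊆S = proj₁ ∘ All.lookup all-low
        ; small = low-small ∘ All.lookup all-low
        ; linked = (x , x∈d , x∈c) ∷ meets-sym aMc ∷ [-]
        ; f-p = x , x∈b , x∈d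
        ; f-q = x , x∈b , x∈c
        ; f-g = meets-sym aMb
        ; g-ℓ = aMc
        ; ℓ∈ = there (here refl)
        ; g-only-ℓ = λ where
            (here refl)         aMd → contradiction aMd ¬aMd
            (there (here refl)) _   → refl
        }

      -- Induced paths and cycles in the line graph

      data Induced : List (Edge H) → Set where
        [-] : ∀ {e} → Induced [ e ]
        _∷_ : ∀ {e e′ es} → Meets e e′ × All (λ w → ¬ Meets e w) es → Induced (e′ ∷ es) → Induced (e ∷ e′ ∷ es)

      -- `g` is the first hyperedge after the head `e` of the path that `f` meets, and `ℓ` is its
      -- predecessor, the only earlier one that `g` meets because the path is induced.
      record FirstMeet (f e : Edge H) (es : List (Edge H)) : Set where
        field
          pre    : List (Edge H)
          g ℓ    : Edge H
          unique : Unique (e ∷ pre ++ [ g ])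
          ⊆path  : pre ++ [ g ] ⊆ es
          linked : Linked (Meets) (e ∷ pre ++ [ g ])
          f-g    : Meets f g
          before : All (λ w → ¬ Meets f w) pre
          ℓ∈     : ℓ ∈ e ∷ pre
          g-ℓ    : Meets g ℓ
          g-only-ℓ : ∀ {w} → w ∈ e ∷ pre → Meets g w → w ≡ ℓ

      firstMeet : ∀ f {e es} → Induced (e ∷ es) → Unique (e ∷ es) → All (λ w → ¬ Meets f w) es ⊎ FirstMeet f e es
      firstMeet f [-] _ = inj₁ []
      firstMeet f {e} {e′ ∷ es} ((eMe′ , ¬eM) ∷ ind) (e≢ ∷ u) with meets? f e′
      ... | yes fMe′ = inj₂ record
        { pre = [] ; g = e′ ; ℓ = e ; unique = (All.head e≢ ∷ []) ∷ [] ∷ []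
        ; ⊆path = λ where (here refl) → here refl
        ; linked = eMe′ ∷ [-] ; f-g = fMe′ ; before = [] ; ℓ∈ = here refl ; g-ℓ = meets-sym eMe′
        ; g-only-ℓ = λ where (here refl) _ → refl }
      ... | no ¬fMe′ with firstMeet f ind u
      ... | inj₁ ¬fM = inj₁ (¬fMe′ ∷ ¬fM)
      ... | inj₂ F = inj₂ record
        { pre = e′ ∷ pre ; g = g ; ℓ = ℓ
        ; unique = All.tabulate (λ w∈ → All.lookup e≢ (⊆path′ w∈)) ∷ unique
        ; ⊆path = ⊆path′
        ; linked = eMe′ ∷ linked ; f-g = f-g ; before = ¬fMe′ ∷ before ; ℓ∈ = there ℓ∈ ; g-ℓ = g-ℓ
        ; g-only-ℓ = λ where
            (here refl) gMe → contradiction (meets-sym gMe) (All.lookup ¬eM (⊆path (∈-++⁺ʳ pre (here refl))))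
            (there w∈)  gMw → g-only-ℓ w∈ gMw }
        where
        open FirstMeet F
        ⊆path′ : e′ ∷ pre ++ [ g ] ⊆ e′ ∷ es
        ⊆path′ (here refl) = here refl
        ⊆path′ (there w∈)  = there (⊆path w∈)

      -- The first chord closes an induced cycle; a third edge p through the point y makes it a configuration.
      close : ∀ {f e e′ es x y} → Low f → All Low (e ∷ e′ ∷ es) → Induced (e ∷ e′ ∷ es) → Unique (e ∷ e′ ∷ es) →
              x ∈ₛ verts H e → x ∈ₛ verts H e′ → y ∈ₛ verts H e → y ∈ₛ verts H f → y ≢ x → f ≢ e →
              FirstMeet f e (e′ ∷ es) → Configuration S
      close {f} {e} {e′} {es} {x} {y} low-f lows@(low-e ∷ low-e′ ∷ _) ((_ , ¬eM) ∷ _) u x∈e x∈e′ y∈e y∈f y≢x f≢e F = go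
        where
        open FirstMeet F
        g∈tail : g ∈ e′ ∷ es
        g∈tail = ⊆path (∈-++⁺ʳ pre (here refl))

        low-tail : ∀ {w} → w ∈ pre ++ [ g ] → Low w
        low-tail w∈ = All.lookup lows (there (⊆path w∈))

        -- Since `k ≥ 2`, at least three hyperedges pass through `y`.
        third : ∃ λ p → p ∈ through H y S × p ∉ e ∷ f ∷ []
        third = avoid (through H y S) (e ∷ f ∷ []) (through-unique y) (≤-trans (s≤s (2≤k low-e)) (through-length≥ low-e y∈e))

        p : Edge H
        p = proj₁ third

        p∉ : p ∉ e ∷ f ∷ []
        p∉ = proj₂ (proj₂ third)

        y∈p : y ∈ₛ verts H p
        y∈p = proj₂ (∈-through⁻ (proj₁ (proj₂ third)))

        low-p : Low p
        low-p = low-neighbour low-e (proj₁ (∈-through⁻ (proj₁ (proj₂ third)))) y∈e y∈p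

        g∈ : g ∈ pre ++ [ g ]
        g∈ = ∈-++⁺ʳ pre (here refl)

        -- Here `f`, `e`, `e′` form a triangle. Its corner `x` is off `f`, because `e` and `f`
        -- already share `y`.
        short-cycle : g ≡ e′ → Configuration S
        short-cycle refl = triangle-configuration low-f low-e low-e′
          (λ where refl → Unique[x∷xs]⇒x∉xs u (here refl)) x∈e x∈e′
          (λ x∈f → f≢e (low-linear low-e (proj₁ low-f) y∈e y∈f x∈e x∈f y≢x))
          (y , y∈f , y∈e) f-g

        module Long (¬eMg : ¬ Meets e g) where
          y∉g : y ∉ₛ verts H g
          y∉g y∈g = ¬eMg (y , y∈e , y∈g)

          -- If `p` meets `g`, then `f`, `p`, `g` form a triangle whose corner `y` is off `g`.
          chord : Meets g p → Configuration S
          chord gMp = triangle-configuration (low-tail g∈) low-f low-p (p∉ ∘ there ∘ here ∘ sym)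
            y∈f y∈p y∉g (meets-sym f-g) gMp

          y∉pre : ∀ {w} → w ∈ pre → y ∉ₛ verts H w
          y∉pre w∈ y∈w = All.lookup before w∈ (y , y∈f , y∈w)

          y∉rest : ∀ {w} → w ∈ pre ++ [ g ] → y ∉ₛ verts H w
          y∉rest w∈ with ∈-++⁻ pre w∈
          ... | inj₁ w∈pre       = y∉pre w∈pre
          ... | inj₂ (here refl) = y∉g

          -- Otherwise the walk is `p`, `e`, `pre`, `g`: both `p` and `e` meet `f` in `y`, and `g`
          -- meets only `ℓ` on it.
          no-chord : ¬ Meets g p → Configuration S
          no-chord ¬gMp = record
            { f = f ; p = p ; q = e ; g = g ; ℓ = ℓ ; rest = pre
            ; unique = ((p∉ ∘ there ∘ here ∘ sym) ∷ f≢e ∷ All.tabulate (∈∉-≢ y∈f ∘ y∉rest))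
                     ∷ ((p∉ ∘ here) ∷ All.tabulate (∈∉-≢ y∈p ∘ y∉rest))
                     ∷ unique
            ; ⊆S = proj₁ ∘ low
            ; small = low-small ∘ low
            ; linked = (y , y∈p , y∈e) ∷ linked
            ; f-p = y , y∈f , y∈p
            ; f-q = y , y∈f , y∈e
            ; f-g = f-g
            ; g-ℓ = g-ℓ
            ; ℓ∈ = there ℓ∈
            ; g-only-ℓ = λ where
                (here refl) gMp → contradiction gMp ¬gMp
                (there w∈)  gMw → g-only-ℓ w∈ gMw
            }
            where
            low : ∀ {w} → w ∈ f ∷ p ∷ e ∷ pre ++ [ g ] → Low w
            low (here refl)                 = low-f
            low (there (here refl))         = low-p
            low (there (there (here refl))) = low-e
            low (there (there (there w∈)))  = low-tail w∈

        go : Configuration S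
        go with g∈tail | meets? g p
        ... | here g≡e′  | _        = short-cycle g≡e′
        ... | there g∈es | yes gMp  = Long.chord (All.lookup ¬eM g∈es) gMp
        ... | there g∈es | no ¬gMp  = Long.no-chord (All.lookup ¬eM g∈es) ¬gMp

      -- The path is prolonged at its head until a new hyperedge meets the path beyond the head.
      -- This must happen, since a path without repetition has at most `length (E H)` entries;
      -- `fuel` bounds the remaining steps.
      grow : ∀ fuel {e e′ es x} → length (E H) < length (e ∷ e′ ∷ es) + fuel →
             All Low (e ∷ e′ ∷ es) → Induced (e ∷ e′ ∷ es) → Unique (e ∷ e′ ∷ es) →
             x ∈ₛ verts H e → x ∈ₛ verts H e′ → Configuration S
      grow zero {e} {e′} {es} bound _ _ u _ _ = contradiction
        (subst₂ _≤_ (sym (+-identityʳ _)) (length-tabulate {n = length (E H)} id) (length-⊆ u λ _ → ∈-allFin _))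
        (<⇒≱ bound)
      grow (suc fuel) {e} {e′} {es} {x} bound lows@(low-e ∷ _) ind u x∈e x∈e′
        -- Leaving `e` at a point other than `x` keeps `x` off `f`, so that a triangle closed by `f`
        -- has distinct corners.
        with y , y∈ , y∉ ← avoid (points (verts H e)) [ x ] (points-unique (verts H e))
               (subst (2 ≤_) (sym (trans (length-points (verts H e)) (proj₂ low-e))) (2≤k low-e))
        with f , f∈ , f∉ ← avoid (through H y S) [ e ] (through-unique y)
               (≤-trans (2≤k low-e) (≤-trans (n≤1+n k) (through-length≥ low-e (∈-points⁻ y∈))))
        = continue (firstMeet f ind u)
        where
        y∈e : y ∈ₛ verts H e
        y∈e = ∈-points⁻ y∈
        y∈f : y ∈ₛ verts H f
        y∈f = proj₂ (∈-through⁻ f∈)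
        low-f : Low f
        low-f = low-neighbour low-e (proj₁ (∈-through⁻ f∈)) y∈e y∈f
        continue : All (λ w → ¬ Meets f w) (e′ ∷ es) ⊎ FirstMeet f e (e′ ∷ es) → Configuration S
        continue (inj₂ F)   = close low-f lows ind u x∈e x∈e′ y∈e y∈f (y∉ ∘ here) (f∉ ∘ here) F
        continue (inj₁ ¬fM) = grow fuel (subst (length (E H) <_) (+-suc _ fuel) bound) (low-f ∷ lows)
          (((y , y∈f , y∈e) , ¬fM) ∷ ind)
          (((f∉ ∘ here) ∷ All.map (λ ¬fMw → λ where refl → ¬fMw (y , y∈f , y∈f)) ¬fM) ∷ u)
          y∈f y∈e

      configuration : ∀ {e} → Low e → Configuration S
      configuration {e} low-e
        with x , x∈e ← All.lookup (edge-nonempty H) (∈-lookup e)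
        with f , f∈ , f∉ ← avoid (through H x S) [ e ] (through-unique x)
               (≤-trans (2≤k low-e) (≤-trans (n≤1+n k) (through-length≥ low-e x∈e)))
        = let f∈S , x∈f = ∈-through⁻ f∈ in
          grow (length (E H)) (s≤s (m≤n+m _ 1)) (low-neighbour low-e f∈S x∈e x∈f ∷ low-e ∷ [])
               (((x , x∈f , x∈e) , []) ∷ [-]) (((f∉ ∘ here) ∷ []) ∷ [] ∷ []) x∈f x∈e

    -- Induction on the set of hyperedges

    removed : ∀ {P : Edge H → Set} (P? : ∀ f → Dec (P f)) {n S e} → length S ≤ suc n → e ∈ S → ¬ P e →
              length (filter P? S) ≤ n
    removed P? S≤ e∈S ¬Pe = ≤-pred (≤-trans (filter-notAll P? _ (lose e∈S ¬Pe)) S≤)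

    colour : ∀ n S → length S ≤ n → Unique S → ∃ λ c → Proper c S
    -- Any constant map will do; a colour exists because `N ≥ 1`.
    colour n [] _ _ = (λ _ → proj₁ (fresh [] (m≤n+m 1 (mΔ (2-section H))))) , λ ()
    colour (suc n) S@(e₀ ∷ S₀) S≤ uS with Any.any? (λ e → length (neighbours e S) <? N) S
    ... | yes light =
      let e , e∈S , room = find light
          ≢e? = λ f → ¬? (f ≟ᶠ e)
          D = filter ≢e? S
          uD = Unique-filter⁺ ≢e? uS
          c , pr = colour n D (removed ≢e? S≤ e∈S (λ e≢e → e≢e refl)) uD
          c′ , pr′ , _ = greedy {c} {D} {e} pr (λ e∈D → proj₂ (∈-filter⁻ ≢e? {xs = S} e∈D) refl)
            (≤-<-trans (neighbours-+ {S} {D} {e} [] [] uD (proj₁ ∘ ∈-filter⁻ ≢e?) λ ()) room)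
      in c′ , proper-⊆ {c′} (cover e) pr′
      where
      cover : ∀ e → S ⊆ e ∷ filter (λ f → ¬? (f ≟ᶠ e)) S
      cover e {f} f∈S with f ≟ᶠ e
      ... | yes f≡e = here f≡e
      ... | no f≢e  = there (∈-filter⁺ (λ f → ¬? (f ≟ᶠ e)) f∈S f≢e)
    -- No hyperedge can be left for last, so a whole configuration, grown from a hyperedge of least
    -- size, is removed and coloured after the rest.
    ... | no ¬light =
      let c , pr = colour n (Configuration.D K) (removed (λ w → ¬? (w ∈? Configuration.C K)) S≤ (Configuration.⊆S K (here refl)) (λ ∉C → ∉C (here refl)))
                     (Unique-filter⁺ (λ w → ¬? (w ∈? Configuration.C K)) uS)
      in configuration-extend K uS {c} pr
      where
      open DecMembership (_≟ᶠ_ {length (E H)}) using (_∈?_)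
      e : Edge H
      e = argmin (size H) e₀ S₀
      e∈S : e ∈ S
      e∈S with argmin-sel (size H) e₀ S₀
      ... | inj₁ e≡  = here e≡
      ... | inj₂ e∈  = there e∈
      minimal : ∀ {f} → f ∈ S → size H e ≤ size H f
      minimal (here refl) = f[argmin]≤f[⊤] {f = size H} e₀ S₀
      minimal (there f∈)  = All.lookup (f[argmin]≤f[xs] {f = size H} e₀ S₀) f∈
      K : Configuration S
      K = Heavy.configuration uS (λ e∈ → ≮⇒≥ (λ <N → ¬light (lose e∈ <N))) (size H e) minimal (e∈S , refl)

-- From the colouring to the chromatic index

theorem3 : (H : Hypergraph) → Loopless H →
    Δ H ≤√ (mΔ (2-section H) + 1) +1 →
    chromaticIndex H ≤ mΔ (2-section H) + 1
theorem3 H loopless Δ-bound =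
  let c , proper = colour H loopless Δ-bound _ (allFin (length (E H))) ≤-refl (allFin⁺ _)
  in proj₂ (chromaticIndex-isLeast H) _ (c , λ e e′ ce≡ce′ → separate (proper (∈-allFin e) (∈-allFin e′)) ce≡ce′)
  where
  separate : ∀ {e e′} {A : Set} → (Meets H e e′ → A → e ≡ e′) → A →
             Empty (verts H e ∩ verts H e′) ⊎ verts H e ≡ verts H e′
  separate {e} {e′} proper ce≡ce′ with e ≟ᶠ e′
  ... | yes refl = inj₂ refl
  ... | no e≢e′  = inj₁ λ (x , x∈) →
    let x∈e , x∈e′ = x∈p∩q⁻ (verts H e) (verts H e′) x∈ in e≢e′ (proper (x , x∈e , x∈e′) ce≡ce′)
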